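{- For each $s \geq 1$ and $n \geq 3$, we have $$R(\mathcal{P}_n^{2s,s},\mathcal{P}_3^{2s,s})=(n+1)s+1.$$
   Context: An $r$-uniform hypergraph $H=(V,E)$ consists of a vertex set $V$ and a collection $E$ of $r$-subsets of $V$; $K_N^r$ denotes the complete $r$-uniform hypergraph on $N$ vertices. For $r$-uniform hypergraphs $H_1,H_2$, the Ramsey number $R(H_1,H_2)$ is the minimum $N$ such that each red-blue coloring of the edges of $K_N^r$ contains either a red copy of $H_1$ or a blue copy of $H_2$. For integers $s,n\ge 1$, the path $\mathcal{P}_n^{2s,s}$ of length $n$ is the $2s$-uniform hypergraph on distinct vertices $v_1,v_2,\ldots,v_{(n+1)s}$ whose $n$ edges are $\{v_{1+is},\ldots,v_{(i+2)s}\}$ for $0\le i\le n-1$. Equivalently, it is given by pairwise disjoint $s$-sets $A_1,\ldots,A_{n+1}$ with edges $A_i\cup A_{i+1}$ for $1\le i\le n$. -}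

module Defs where

open import Data.Bool.Base using (false; _∧_)
open import Data.Fin.Base using (Fin; zero; suc; toℕ)
open import Data.Fin.Properties using (any?; toℕ<n) renaming (_≟_ to _≟ᶠ_)
open import Data.Fin.Subset using (Subset; ∣_∣)
open import Data.Fin.Subset.Properties using (_∈?_)
open import Data.Nat.Base using (ℕ; zero; suc; _+_; _*_; _∸_; _≤_; z≤n; s≤s)
open import Data.Nat.Properties
  using (_≤?_; _<?_; *-distribʳ-∸; *-monoˡ-≤; m+n∸n≡m; +-comm; ≤-reflexive; ≤-trans)
open import Data.Product.Base using (Σ; ∃; _×_; _,_)
open import Data.Sum.Base using (_⊎_)
open import Data.Vec.Base using (tabulate)
open import Data.Vec.Properties using (tabulate-cong)
open import Function.Definitions using (Injective)
open import Level using (0ℓ)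
open import Relation.Binary.PropositionalEquality
  using (_≡_; refl; trans; cong; module ≡-Reasoning)
open import Relation.Nullary.Decidable using (does; _×-dec_)
open import Relation.Unary using (Pred; Decidable)

comprehension : ∀ {m} {P : Pred (Fin m) 0ℓ} → Decidable P → Subset m
comprehension P? = tabulate (λ x → does (P? x))

image : ∀ {m k} → (Fin m → Fin k) → Subset m → Subset k
image f p = comprehension (λ y → any? (λ x → (x ∈? p) ×-dec (f x ≟ᶠ y)))

record Hypergraph (r : ℕ) : Set₁ where
  field
    order   : ℕ
    Edge    : Pred (Subset order) 0ℓ
    uniform : ∀ {e} → Edge e → ∣ e ∣ ≡ r

open Hypergraph public

-- G contains a (not necessarily induced) copy of H.
infix 4 _↪_
_↪_ : ∀ {r} → Hypergraph r → Hypergraph r → Set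
H ↪ G = Σ (Fin (order H) → Fin (order G)) λ f →
  Injective _≡_ _≡_ f × (∀ {e} → Edge H e → Edge G (image f e))

complete : (r N : ℕ) → Hypergraph r
complete r N = record
  { order   = N
  ; Edge    = λ e → ∣ e ∣ ≡ r
  ; uniform = λ ∣e∣≡r → ∣e∣≡r
  }

data Colour : Set where
  red blue : Colour

-- The edges of complete r N carry a proof of an equation in ℕ, which is unique,
-- so a colouring of it gives each r-subset exactly one colour.
Colouring : ∀ {r} → Hypergraph r → Set
Colouring G = ∃ (Edge G) → Colour

colourClass : ∀ {r} (G : Hypergraph r) → Colouring G → Colour → Hypergraph r
colourClass G χ c = record
  { order   = order G
  ; Edge    = λ e → Σ (Edge G e) λ e∈G → χ (e , e∈G) ≡ c
  ; uniform = λ (e∈G , _) → uniform G e∈G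
  }

Arrows : ∀ {r} → ℕ → Hypergraph r → Hypergraph r → Set
Arrows {r} N H₁ H₂ = (χ : Colouring (complete r N)) →
  (H₁ ↪ colourClass (complete r N) χ red) ⊎ (H₂ ↪ colourClass (complete r N) χ blue)

-- The relation R(H₁, H₂) = N; it includes the existence of the minimum.
IsRamseyNumber : ∀ {r} → Hypergraph r → Hypergraph r → ℕ → Set
IsRamseyNumber H₁ H₂ N = Arrows N H₁ H₂ × (∀ M → Arrows M H₁ H₂ → N ≤ M)

-- The elements x of Fin m with a ≤ x < b.
interval : (m a b : ℕ) → Subset m
interval m a b = comprehension {m} (λ x → (a ≤? toℕ x) ×-dec (toℕ x <? b))

private
  shift : ∀ a k → does (suc a ≤? suc k) ≡ does (a ≤? k)
  shift zero    k = refl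
  shift (suc a) k = refl

∣interval∣ : ∀ {m a b} → b ≤ m → ∣ interval m a b ∣ ≡ b ∸ a
∣interval∣ {zero}  {zero}  z≤n = refl
∣interval∣ {zero}  {suc a} z≤n = refl
∣interval∣ {suc m} {zero}  {zero}  z≤n = ∣interval∣ {m} {zero} {zero} z≤n
∣interval∣ {suc m} {suc a} {zero}  z≤n =
  trans (cong ∣_∣ (tabulate-cong {n = m} (λ x → cong (_∧ false) (shift a (toℕ x)))))
        (trans (∣interval∣ {m} {a} {zero} z≤n) (0∸ a))
  where
  0∸ : ∀ a → 0 ∸ a ≡ 0
  0∸ zero    = refl
  0∸ (suc _) = refl
∣interval∣ {suc m} {zero}  {suc b} (s≤s b≤m) = cong suc (∣interval∣ {m} {zero} b≤m)
∣interval∣ {suc m} {suc a} {suc b} (s≤s b≤m) =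
  trans (cong ∣_∣ (tabulate-cong {n = m}
          (λ x → cong (_∧ does (toℕ x <? b)) (shift a (toℕ x)))))
        (∣interval∣ {m} {a} b≤m)

-- Vertices and edges are indexed from 0, so the vertex v_{j+1} is j : Fin ((n + 1) * s).
pathEdge : (n s : ℕ) → Fin n → Subset ((n + 1) * s)
pathEdge n s i = interval ((n + 1) * s) (toℕ i * s) ((toℕ i + 2) * s)

∣pathEdge∣ : ∀ n s i → ∣ pathEdge n s i ∣ ≡ 2 * s
∣pathEdge∣ n s i = begin
  ∣ pathEdge n s i ∣                ≡⟨ ∣interval∣ {a = toℕ i * s} (*-monoˡ-≤ s i+2≤n+1) ⟩
  (toℕ i + 2) * s ∸ toℕ i * s       ≡⟨ *-distribʳ-∸ s (toℕ i + 2) (toℕ i) ⟨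
  (toℕ i + 2 ∸ toℕ i) * s           ≡⟨ cong (λ k → (k ∸ toℕ i) * s) (+-comm (toℕ i) 2) ⟩
  (2 + toℕ i ∸ toℕ i) * s           ≡⟨ cong (_* s) (m+n∸n≡m 2 (toℕ i)) ⟩
  2 * s                             ∎
  where
  open ≡-Reasoning
  i+2≤n+1 : toℕ i + 2 ≤ n + 1
  i+2≤n+1 = ≤-trans (≤-reflexive (+-comm (toℕ i) 2))
              (≤-trans (s≤s (toℕ<n i)) (≤-reflexive (+-comm 1 n)))

path : (n s : ℕ) → Hypergraph (2 * s)
path n s = record
  { order   = (n + 1) * s
  ; Edge    = λ e → ∃ λ (i : Fin n) → e ≡ pathEdge n s i
  ; uniform = λ { (i , refl) → ∣pathEdge∣ n s i }
  }

{-# OPTIONS --safe #-}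

-- For the lower bound, colour an edge blue when it contains a fixed vertex: a red
-- path avoids that vertex, and the first and third edges of a blue path are disjoint.
--
-- For the upper bound, cut all vertices but one spare vertex w into n + 1 blocks of
-- size s and colour a pair of blocks like its union.  A 2-coloured complete graph
-- on at least four vertices has a red Hamiltonian path, a blue path on four vertices,
-- a blue spanning star or, on exactly four vertices, a blue triangle; only the last two
-- need work.  If there is no red Pₙ and no blue P₃, then the star (or triangle)
-- survives the exchange of w with any vertex in a block.  Such exchanges generate
-- all permutations, so the centre can trade all its vertices with a leaf (a corner
-- of the triangle with the isolated block); both configurations together contain
-- a blue P₃.
module Submission where

open import Defs
open import Data.Fin.Base using (Fin; zero; suc; toℕ; cast; inject₁; fromℕ; punchOut)
open import Data.Fin.Properties as Fin
  using (any?; toℕ-cast; toℕ-injective; toℕ-inject₁; toℕ-fromℕ; toℕ<n; injective⇒≤; punchOut-injective)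
open import Data.Fin.Subset using (Subset; ∣_∣; _∈_; _-_; _⊆_; inside; outside)
open import Data.Fin.Subset.Properties
  using (_∈?_; x∈p∧x≢y⇒x∈p-y; x∈p⇒∣p-x∣<∣p∣; ⊆-antisym)
open import Data.List.Base
  using (List; []; _∷_; _++_; [_]; _∷ʳ_; length; concat; lookup; take; drop; tabulate; initLast; _∷ʳ′_)
open import Data.List.Membership.Propositional using () renaming (_∈_ to _∈ₗ_)
open import Data.List.Membership.Propositional.Properties using (∈-lookup)
open import Data.List.Properties
  using (concat-++; length-++; ++-assoc; length-take; length-drop; take++drop≡id; length-tabulate)
open import Data.List.Relation.Binary.Permutation.Propositional
  using (_↭_; prep; swap; ↭-refl; ↭-sym; ↭-trans; ↭-reflexive; ↭⇒↭ₛ)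
open import Data.List.Relation.Binary.Permutation.Propositional.Properties
  using (shift; shifts; ++⁺ˡ; ++⁺ʳ; ++-comm; ↭-length; ∈-resp-↭; All-resp-↭)
import Data.List.Relation.Binary.Permutation.Setoid.Properties as Permutationₛ
open import Data.List.Relation.Unary.All as All using (All; []; _∷_)
import Data.List.Relation.Unary.All.Properties as All
open import Data.List.Relation.Unary.AllPairs using ([]; _∷_)
open import Data.List.Relation.Unary.Any using (here; there)
open import Data.List.Relation.Unary.Linked as Linked using (Linked; []; [-]; _∷_)
open import Data.List.Relation.Unary.Unique.Propositional using (Unique)
open import Data.List.Relation.Unary.Unique.Propositional.Properties using (allFin⁺)
open import Data.Nat.Base
  using (ℕ; zero; suc; pred; _+_; _*_; _∸_; _≤_; _<_; _≥_; z≤n; s≤s)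
open import Data.Nat.Properties
  using (_≟_; _≤?_; _<?_; ≤-trans; ≤-reflexive; ≤-antisym; ≡-irrelevant; +-comm; +-suc; +-identityʳ;
         +-monoˡ-≤; *-monoˡ-≤; *-distribʳ-+; m≤m+n; m≤n⇒m⊓n≡m; m+n∸m≡n; ≮⇒≥; <⇒≱)
open import Data.Product.Base using (∃; ∃₂; _×_; _,_; proj₁; proj₂)
open import Data.Sum.Base using (_⊎_; inj₁; inj₂; map₂)
open import Data.Vec.Base using ([]; _∷_; here; there)
open import Data.Vec.Properties using ([]=⇒lookup; lookup⇒[]=; lookup∘tabulate)
open import Function.Base using (_∘_)
open import Function.Definitions using (Injective)
open import Level using (0ℓ)
open import Relation.Binary.Core using (Rel)
open import Relation.Binary.PropositionalEquality
  using (_≡_; _≢_; refl; sym; trans; cong; cong₂; subst; subst₂; setoid)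
open import Relation.Nullary using (yes; no; contradiction)
open import Relation.Nullary.Decidable using (does; dec-true; _×-dec_)
open import Relation.Unary using (Pred; Decidable)

-- Two-coloured complete graphs

module _ {A : Set} where

  -- A concrete permutation is written pickᵢ (pickⱼ …): the positions, in what is left
  -- of the target list, of the successive entries of the source list.
  pick : ∀ pre {x : A} {post l} → l ↭ pre ++ post → x ∷ l ↭ pre ++ x ∷ post
  pick pre p = ↭-trans (prep _ p) (↭-sym (shift _ pre _))

  pick₀ : ∀ {x : A} {post l} → l ↭ post → x ∷ l ↭ x ∷ post
  pick₀ = pick []

  pick₁ : ∀ {a x : A} {post l} → l ↭ a ∷ post → x ∷ l ↭ a ∷ x ∷ post
  pick₁ = pick (_ ∷ [])

  pick₂ : ∀ {a b x : A} {post l} → l ↭ a ∷ b ∷ post → x ∷ l ↭ a ∷ b ∷ x ∷ post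
  pick₂ = pick (_ ∷ _ ∷ [])

  pick₃ : ∀ {a b c x : A} {post l} → l ↭ a ∷ b ∷ c ∷ post → x ∷ l ↭ a ∷ b ∷ c ∷ x ∷ post
  pick₃ = pick (_ ∷ _ ∷ _ ∷ [])

  module _ {R : Rel A 0ℓ} where

    Linked-glue : ∀ xs {z ys} → Linked R (xs ∷ʳ z) → Linked R (z ∷ ys) → Linked R (xs ++ z ∷ ys)
    Linked-glue []           _        q = q
    Linked-glue (x ∷ [])     (r ∷ p)  q = r ∷ q
    Linked-glue (x ∷ y ∷ xs) (r ∷ p)  q = r ∷ Linked-glue (y ∷ xs) p q

    Linked-prefix : ∀ xs {z ys} → Linked R (xs ++ z ∷ ys) → Linked R (xs ∷ʳ z)
    Linked-prefix []           _       = [-]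
    Linked-prefix (x ∷ [])     (r ∷ p) = r ∷ [-]
    Linked-prefix (x ∷ y ∷ xs) (r ∷ p) = r ∷ Linked-prefix (y ∷ xs) p

    Linked-suffix : ∀ xs {ys} → Linked R (xs ++ ys) → Linked R ys
    Linked-suffix []       p = p
    Linked-suffix (x ∷ xs) p = Linked-suffix xs (Linked.tail p)

module ColouredGraph {X : Set} (col : X → X → Colour) (col-sym : ∀ x y → col x y ≡ col y x) where

  Red Blue : Rel X 0ℓ
  Red  x y = col x y ≡ red
  Blue x y = col x y ≡ blue

  flip : ∀ {c} x y → col x y ≡ c → col y x ≡ c
  flip x y = trans (col-sym y x)

  colour : ∀ x y → Red x y ⊎ Blue x y
  colour x y with col x y
  ... | red  = inj₁ refl
  ... | blue = inj₂ refl

  allBlueOrRed : ∀ v l → All (Blue v) l ⊎ (∃ λ y → ∃₂ λ pre post → l ≡ pre ++ y ∷ post × Red v y)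
  allBlueOrRed v []      = inj₁ []
  allBlueOrRed v (x ∷ l) with colour v x | allBlueOrRed v l
  ... | inj₁ r | _ = inj₂ (x , [] , l , refl , r)
  ... | inj₂ b | inj₁ bs = inj₁ (b ∷ bs)
  ... | inj₂ b | inj₂ (y , pre , post , eq , r) = inj₂ (y , x ∷ pre , post , cong (x ∷_) eq , r)

  -- The index counts vertices; with blocks for vertices this becomes `path 3 s`, whose index counts
  -- edges.
  record BlueP₄ (xs : List X) : Set where
    constructor blueP₄
    field
      {a b c d} : X
      {rest}    : List X
      covers    : a ∷ b ∷ c ∷ d ∷ rest ↭ xs
      ab        : Blue a b
      bc        : Blue b c
      cd        : Blue c d

  BlueP₄-resp-↭ : ∀ {xs ys} → xs ↭ ys → BlueP₄ xs → BlueP₄ ys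
  BlueP₄-resp-↭ q (blueP₄ p ab bc cd) = blueP₄ (↭-trans p q) ab bc cd

  BlueP₄-∷ : ∀ {v xs} → BlueP₄ xs → BlueP₄ (v ∷ xs)
  BlueP₄-∷ {v} (blueP₄ p ab bc cd) =
    blueP₄ (↭-trans (pick₁ (pick₁ (pick₁ (pick₁ ↭-refl)))) (prep v p)) ab bc cd

  -- A blue edge `y z` between consecutive leaves would give the blue path `y z c e`; the leaf `e`
  -- is set aside to serve as its end.
  leavesButOne-red : ∀ {c e} ls → All (Blue c) (e ∷ ls) → BlueP₄ (c ∷ e ∷ ls) ⊎ Linked Red ls
  leavesButOne-red [] _ = inj₂ []
  leavesButOne-red (y ∷ []) _ = inj₂ [-]
  leavesButOne-red {c} {e} (y ∷ z ∷ ls) (ce ∷ cy ∷ cz ∷ cls)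
    with colour y z | leavesButOne-red (z ∷ ls) (ce ∷ cz ∷ cls)
  ... | inj₂ yz | _       = inj₁ (blueP₄ (pick₂ (pick₂ ↭-refl)) yz (flip c z cz) ce)
  ... | inj₁ yz | inj₁ p4 = inj₁ (BlueP₄-resp-↭ (pick₂ ↭-refl) (BlueP₄-∷ p4))
  ... | inj₁ yz | inj₂ l  = inj₂ (yz ∷ l)

  -- The first leaf `a` can be set aside for every later pair. For the pair `a b` itself the third
  -- leaf `d` takes over: the blue path would be `a b c d`.
  leaves-red : ∀ {c} ls → 3 ≤ length ls → All (Blue c) ls → BlueP₄ (c ∷ ls) ⊎ Linked Red ls
  leaves-red (_ ∷ [])      (s≤s ()) _
  leaves-red (_ ∷ _ ∷ []) (s≤s (s≤s ())) _
  leaves-red {c} (a ∷ b ∷ d ∷ ls) _ (ca ∷ cs@(cb ∷ cd ∷ _)) with colour a b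
  ... | inj₂ ab = inj₁ (blueP₄ (pick₁ (pick₁ ↭-refl)) ab (flip c b cb) cd)
  ... | inj₁ ab = map₂ (ab ∷_) (leavesButOne-red (b ∷ d ∷ ls) (ca ∷ cs))

  -- These alternatives persist as a family when a vertex is added, so `outcome` can proceed by
  -- induction. In `blueK₃+K₁` the colours at `d` are left open.
  data Outcome (xs : List X) : Set where
    redPath   : ∀ ys → ys ↭ xs → Linked Red ys → Outcome xs
    blueP₄    : BlueP₄ xs → Outcome xs
    blueStar  : ∀ c ls → c ∷ ls ↭ xs → All (Blue c) ls → Outcome xs
    blueK₃+K₁ : ∀ a b c d → a ∷ b ∷ c ∷ d ∷ [] ↭ xs → Blue a b → Blue b c → Blue a c → Outcome xs

  Outcome-resp-↭ : ∀ {xs ys} → xs ↭ ys → Outcome xs → Outcome ys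
  Outcome-resp-↭ q (redPath ys p l)   = redPath ys (↭-trans p q) l
  Outcome-resp-↭ q (blueP₄ p)         = blueP₄ (BlueP₄-resp-↭ q p)
  Outcome-resp-↭ q (blueStar c ls p b) = blueStar c ls (↭-trans p q) b
  Outcome-resp-↭ q (blueK₃+K₁ a b c d p x y z) = blueK₃+K₁ a b c d (↭-trans p q) x y z

  -- A red neighbour `y` of `v` lets the cycle be opened just after `y`, with `v` attached behind
  -- `y`; without one, `v` is the centre of a blue star.
  extendCycle : ∀ v x l → Linked Red (x ∷ l ∷ʳ x) → Outcome (v ∷ x ∷ l)
  extendCycle v x l cyc with allBlueOrRed v (x ∷ l)
  ... | inj₁ bs = blueStar v (x ∷ l) ↭-refl bs
  ... | inj₂ (.x , [] , .l , refl , vx) =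
    redPath (l ++ x ∷ v ∷ [])
      (↭-trans (shift x l [ v ]) (↭-trans (prep x (++-comm l [ v ])) (pick₁ ↭-refl)))
      (Linked-glue l (Linked.tail cyc) (flip v x vx ∷ [-]))
  ... | inj₂ (y , .x ∷ pre , post , refl , vy) =
    redPath (post ++ x ∷ pre ++ y ∷ v ∷ [])
      (↭-trans (++-comm post _)
        (↭-trans (++⁺ʳ post (↭-reflexive (sym (++-assoc (x ∷ pre) [ y ] [ v ]))))
          (↭-trans (++⁺ʳ post (++-comm (x ∷ pre ∷ʳ y) [ v ]))
            (↭-reflexive (cong (v ∷_) (++-assoc (x ∷ pre) [ y ] post))))))
      (Linked-glue post (Linked.tail (Linked-suffix (x ∷ pre) cyc′))
        (Linked-glue (x ∷ pre) (Linked-prefix (x ∷ pre) cyc′) (flip v y vy ∷ [-])))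
    where
    cyc′ : Linked Red (x ∷ pre ++ y ∷ post ∷ʳ x)
    cyc′ = subst (Linked Red) (++-assoc (x ∷ pre) (y ∷ post) [ x ]) cyc

  -- Only the case of v blue to both ends x and z of the path is not immediate.  If z x is
  -- red, the path closes to a cycle.  If it is blue, then v x z is a blue triangle, and
  -- without a blue P₄ every edge leaving it is red, so v fits between a and b.
  extendPath : ∀ v xs → 3 ≤ length xs → Linked Red xs → Outcome (v ∷ xs)
  extendPath v (_ ∷ []) (s≤s ()) _
  extendPath v (x ∷ a ∷ l) len p with initLast l
  extendPath v (x ∷ a ∷ .[]) (s≤s (s≤s ())) p | []
  extendPath v (x ∷ a ∷ .(mid ∷ʳ z)) _ p@(xa ∷ _) | mid ∷ʳ′ z
    with colour v x | colour z v | colour z x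
  ... | inj₁ vx | _ | _ = redPath _ ↭-refl (vx ∷ p)
  ... | inj₂ vx | inj₁ zv | _ = redPath (x ∷ a ∷ mid ++ z ∷ v ∷ [])
        (↭-trans (↭-reflexive (sym (++-assoc (x ∷ a ∷ mid) [ z ] [ v ]))) (++-comm (x ∷ a ∷ mid ∷ʳ z) [ v ]))
        (Linked-glue (x ∷ a ∷ mid) p (zv ∷ [-]))
  ... | inj₂ vx | inj₂ zv | inj₁ zx = extendCycle v x (a ∷ mid ∷ʳ z)
        (subst (Linked Red) (sym (++-assoc (x ∷ a ∷ mid) [ z ] [ x ]))
           (Linked-glue (x ∷ a ∷ mid) p (zx ∷ [-])))
  -- The path is just `x a z`: there is no `b`, and the exceptional four-vertex outcome arises.
  extendPath v (x ∷ a ∷ .([] ∷ʳ z)) _ p | [] ∷ʳ′ z | inj₂ vx | inj₂ zv | inj₂ zx =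
    blueK₃+K₁ v x z a (pick₀ (pick₀ (pick₁ ↭-refl))) vx (flip z x zx) (flip z v zv)
  extendPath v (x ∷ a ∷ .((b ∷ mid) ∷ʳ z)) _ (xa ∷ ab ∷ p) | (b ∷ mid) ∷ʳ′ z | inj₂ vx | inj₂ zv | inj₂ zx
    with colour a v | colour v b
  ... | inj₂ av | _ =
      blueP₄ (blueP₄ (pick₂ (pick₀ (pick₀ (pick (b ∷ mid) ↭-refl)))) av vx (flip z x zx))
  ... | inj₁ av | inj₂ vb =
      blueP₄ (blueP₄ (pick₃ (pick₀ (pick₀ (pick (a ∷ mid) ↭-refl)))) (flip v b vb) vx (flip z x zx))
  ... | inj₁ av | inj₁ vb = redPath (x ∷ a ∷ v ∷ b ∷ mid ∷ʳ z) (pick₁ (pick₁ ↭-refl)) (xa ∷ av ∷ vb ∷ p)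

  -- Let `c v` be red. If `v a` is blue, `v a c b` is a blue path. Otherwise `c v` is continued
  -- through the leaves in red; with only two leaves a blue edge `a b` prevents this and closes the
  -- triangle `c a b`.
  extendStar : ∀ v c ls → 2 ≤ length ls → All (Blue c) ls → Outcome (v ∷ c ∷ ls)
  extendStar v c (_ ∷ []) (s≤s ()) _
  extendStar v c (a ∷ b ∷ ls) _ cs@(ca ∷ cb ∷ _) with colour c v | colour v a
  ... | inj₂ cv | _ = blueStar c (v ∷ a ∷ b ∷ ls) (pick₁ ↭-refl) (cv ∷ cs)
  ... | inj₁ cv | inj₂ va = blueP₄ (blueP₄ (pick₀ (pick₁ ↭-refl)) va (flip c a ca) cb)
  extendStar v c (a ∷ b ∷ []) _ cs@(ca ∷ cb ∷ _) | inj₁ cv | inj₁ va with colour a b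
  ... | inj₁ ab = redPath (c ∷ v ∷ a ∷ b ∷ []) (pick₁ ↭-refl) (cv ∷ va ∷ ab ∷ [-])
  ... | inj₂ ab = blueK₃+K₁ c a b v (pick₁ (pick₁ (pick₁ ↭-refl))) ca ab cb
  extendStar v c ls@(a ∷ b ∷ d ∷ _) _ cs | inj₁ cv | inj₁ va with leaves-red ls (s≤s (s≤s (s≤s z≤n))) cs
  ... | inj₁ p4 = blueP₄ (BlueP₄-∷ p4)
  ... | inj₂ l  = redPath (c ∷ v ∷ ls) (pick₁ ↭-refl) (cv ∷ va ∷ l)

  -- The red path sought, `a d b v c`, alternates between corners and other vertices. If one of its
  -- edges is blue, that edge and two sides of the triangle form a blue path.
  extendK₃+K₁ : ∀ v a b c d → Blue a b → Blue b c → Blue a c → Outcome (v ∷ a ∷ b ∷ c ∷ d ∷ [])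
  extendK₃+K₁ v a b c d ab bc ac with colour a d | colour d b | colour b v | colour v c
  ... | inj₂ ad | _ | _ | _ =
      blueP₄ (blueP₄ (pick (_ ∷ _ ∷ _ ∷ _ ∷ []) (pick₁ (pick₁ (pick₁ ↭-refl)))) (flip a d ad) ab bc)
  ... | inj₁ _ | inj₂ db | _ | _ =
      blueP₄ (blueP₄ (pick (_ ∷ _ ∷ _ ∷ _ ∷ []) (pick₂ (pick₁ (pick₁ ↭-refl)))) db (flip a b ab) ac)
  ... | inj₁ _ | inj₁ _ | inj₂ bv | _ =
      blueP₄ (blueP₄ (pick₀ (pick₁ (pick₀ (pick₀ ↭-refl)))) (flip b v bv) (flip a b ab) ac)
  ... | inj₁ _ | inj₁ _ | inj₁ _ | inj₂ vc =
      blueP₄ (blueP₄ (pick₀ (pick₂ (pick₀ (pick₀ ↭-refl)))) vc (flip a c ac) ab)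
  ... | inj₁ ad | inj₁ db | inj₁ bv | inj₁ vc =
    redPath (a ∷ d ∷ b ∷ v ∷ c ∷ []) (pick₁ (pick₃ (pick₁ (pick₀ (pick₀ ↭-refl))))) (ad ∷ db ∷ bv ∷ vc ∷ [-])

  -- Two of the three edges share a colour, and they meet in a vertex: in red they make the path, in
  -- blue the star.
  outcome-triple : ∀ a b c → Outcome (a ∷ b ∷ c ∷ [])
  outcome-triple a b c with colour a b | colour a c | colour b c
  ... | inj₁ ab | _ | inj₁ bc = redPath (a ∷ b ∷ c ∷ []) ↭-refl (ab ∷ bc ∷ [-])
  ... | inj₁ ab | inj₁ ac | _ = redPath (b ∷ a ∷ c ∷ []) (pick₁ ↭-refl) (flip a b ab ∷ ac ∷ [-])
  ... | _ | inj₁ ac | inj₁ bc = redPath (a ∷ c ∷ b ∷ []) (pick₀ (pick₁ ↭-refl)) (ac ∷ flip b c bc ∷ [-])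
  ... | inj₂ ab | inj₂ ac | _ = blueStar a (b ∷ c ∷ []) ↭-refl (ab ∷ ac ∷ [])
  ... | inj₂ ab | _ | inj₂ bc = blueStar b (a ∷ c ∷ []) (pick₁ ↭-refl) (flip a b ab ∷ bc ∷ [])
  ... | _ | inj₂ ac | inj₂ bc = blueStar c (a ∷ b ∷ []) (pick₂ ↭-refl) (flip a c ac ∷ flip b c bc ∷ [])

  outcome : ∀ xs → 3 ≤ length xs → Outcome xs
  outcome (_ ∷ []) (s≤s ())
  outcome (_ ∷ _ ∷ []) (s≤s (s≤s ()))
  outcome (a ∷ b ∷ c ∷ []) _ = outcome-triple a b c
  outcome (v ∷ xs@(_ ∷ _ ∷ _ ∷ _)) _ with outcome xs (s≤s (s≤s (s≤s z≤n)))
  ... | redPath ys p l = Outcome-resp-↭ (prep v p)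
          (extendPath v ys (≤-trans (s≤s (s≤s (s≤s z≤n))) (≤-reflexive (sym (↭-length p)))) l)
  ... | blueP₄ p4 = blueP₄ (BlueP₄-∷ p4)
  ... | blueStar c ls p bs = Outcome-resp-↭ (prep v p) (extendStar v c ls (two p) bs)
    where
    two : ∀ {c : X} {ls a b d xs} → c ∷ ls ↭ a ∷ b ∷ d ∷ xs → 2 ≤ length ls
    two p with ↭-length p
    two {ls = _ ∷ _ ∷ _} _ | _ = s≤s (s≤s z≤n)
  ... | blueK₃+K₁ a b c d p ab bc ac = Outcome-resp-↭ (prep v p) (extendK₃+K₁ v a b c d ab bc ac)

-- Paths from sequences of blocks

module _ {m} {P : Pred (Fin m) 0ℓ} (P? : Decidable P) where

  ∈-comprehension⁺ : ∀ {x} → P x → x ∈ comprehension P?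
  ∈-comprehension⁺ {x} px = lookup⇒[]= x _ (trans (lookup∘tabulate _ x) (dec-true (P? x) px))

  ∈-comprehension⁻ : ∀ {x} → x ∈ comprehension P? → P x
  ∈-comprehension⁻ {x} x∈ with P? x | trans (sym (lookup∘tabulate (does ∘ P?) x)) ([]=⇒lookup x∈)
  ... | yes px | _ = px

∈-image⁺ : ∀ {m k} (f : Fin m → Fin k) {p x} → x ∈ p → f x ∈ image f p
∈-image⁺ f {p} x∈p =
  ∈-comprehension⁺ (λ y → any? (λ x → (x ∈? p) ×-dec (f x Fin.≟ y))) (_ , x∈p , refl)

∈-image⁻ : ∀ {m k} (f : Fin m → Fin k) p {y} → y ∈ image f p → ∃ λ x → x ∈ p × f x ≡ y
∈-image⁻ f p = ∈-comprehension⁻ (λ y → any? (λ x → (x ∈? p) ×-dec (f x Fin.≟ y)))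

∈-interval⁺ : ∀ {m a b} {x : Fin m} → a ≤ toℕ x → toℕ x < b → x ∈ interval m a b
∈-interval⁺ {a = a} {b} a≤x x<b =
  ∈-comprehension⁺ (λ x → (a ≤? toℕ x) ×-dec (toℕ x <? b)) (a≤x , x<b)

∈-interval⁻ : ∀ {m} a b {x : Fin m} → x ∈ interval m a b → a ≤ toℕ x × toℕ x < b
∈-interval⁻ a b = ∈-comprehension⁻ (λ x → (a ≤? toℕ x) ×-dec (toℕ x <? b))

-- Induction on `p`, deleting from `q` the partner of each element. A relation in place of a
-- function lets `∣image∣` use both `f` and its converse.
∣∣-mono-injection : ∀ {m k} (R : Fin m → Fin k → Set) (p : Subset m) (q : Subset k) →
  (∀ {x} → x ∈ p → ∃ λ y → y ∈ q × R x y) →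
  (∀ {x x′ y} → R x y → R x′ y → x ≡ x′) → ∣ p ∣ ≤ ∣ q ∣
∣∣-mono-injection R [] q total inj = z≤n
∣∣-mono-injection R (outside ∷ p) q total inj =
  ∣∣-mono-injection (R ∘ suc) p q (total ∘ there) (λ r r′ → Fin.suc-injective (inj r r′))
∣∣-mono-injection R (inside ∷ p) q total inj with total here
... | y₀ , y₀∈q , Ry₀ = ≤-trans (s≤s (∣∣-mono-injection (R ∘ suc) p (q - y₀) total′
        (λ r r′ → Fin.suc-injective (inj r r′)))) (x∈p⇒∣p-x∣<∣p∣ y₀∈q)
  where
  total′ : ∀ {x} → x ∈ p → ∃ λ y → y ∈ (q - y₀) × R (suc x) y
  total′ x∈p with total (there x∈p)
  ... | y , y∈q , Ry = y , x∈p∧x≢y⇒x∈p-y y∈q (λ { refl → contradiction (inj Ry₀ Ry) λ () }) , Ry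

∣image∣ : ∀ {m k} (f : Fin m → Fin k) → Injective _≡_ _≡_ f → ∀ p → ∣ image f p ∣ ≡ ∣ p ∣
∣image∣ f inj p = ≤-antisym
  (∣∣-mono-injection (λ y x → f x ≡ y) (image f p) p (∈-image⁻ f p) (λ e e′ → trans (sym e) e′))
  (∣∣-mono-injection (λ x y → f x ≡ y) p (image f p) (λ x∈p → _ , ∈-image⁺ f x∈p , refl)
    (λ e e′ → inj (trans e (sym e′))))

lookup-injective : ∀ {A : Set} {l : List A} → Unique l → ∀ {i j} → lookup l i ≡ lookup l j → i ≡ j
lookup-injective (x∉ ∷ u) {zero}  {zero}  _ = refl
lookup-injective (x∉ ∷ u) {zero}  {suc j} e = contradiction e (All.lookup x∉ (∈-lookup j))
lookup-injective (x∉ ∷ u) {suc i} {zero}  e = contradiction (sym e) (All.lookup x∉ (∈-lookup i))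
lookup-injective (x∉ ∷ u) {suc i} {suc j} e = cong suc (lookup-injective u e)

-- Edges of `path` are intervals of positions; this and `lookup-segment⁻` translate them into
-- stretches of a list of vertices.
lookup-segment⁺ : ∀ {A : Set} {x : A} pre mid post → x ∈ₗ mid →
  ∃ λ j → length pre ≤ toℕ j × toℕ j < length pre + length mid × lookup (pre ++ mid ++ post) j ≡ x
lookup-segment⁺ [] (_ ∷ mid) post (here refl) = zero , z≤n , s≤s z≤n , refl
lookup-segment⁺ [] (_ ∷ mid) post (there x∈) with lookup-segment⁺ [] mid post x∈
... | j , _ , j< , e = suc j , z≤n , s≤s j< , e
lookup-segment⁺ (_ ∷ pre) mid post x∈ with lookup-segment⁺ pre mid post x∈
... | j , ≤j , j< , e = suc j , s≤s ≤j , s≤s j< , e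

lookup-segment⁻ : ∀ {A : Set} (pre mid post : List A) (j : Fin (length (pre ++ mid ++ post))) →
  length pre ≤ toℕ j → toℕ j < length pre + length mid → lookup (pre ++ mid ++ post) j ∈ₗ mid
lookup-segment⁻ [] (_ ∷ mid) post zero    _ _ = here refl
lookup-segment⁻ [] (_ ∷ mid) post (suc j) _ (s≤s j<) = there (lookup-segment⁻ [] mid post j z≤n j<)
lookup-segment⁻ (_ ∷ pre) mid post (suc j) (s≤s ≤j) (s≤s j<) = lookup-segment⁻ pre mid post j ≤j j<

length-concat : ∀ {A : Set} {s} (Bs : List (List A)) → All (λ B → length B ≡ s) Bs →
  length (concat Bs) ≡ length Bs * s
length-concat []       []         = refl
length-concat (B ∷ Bs) (eq ∷ eqs) = trans (length-++ B) (cong₂ _+_ eq (length-concat Bs eqs))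

Linked-split : ∀ {A : Set} {R : A → A → Set} {l} → Linked R l → ∀ i → suc i < length l →
  ∃₂ λ pre x → ∃₂ λ y post → l ≡ pre ++ x ∷ y ∷ post × length pre ≡ i × R x y
Linked-split [-] _ (s≤s ())
Linked-split (r ∷ _) zero _ = [] , _ , _ , _ , refl , refl , r
Linked-split (_∷_ {x = x} _ p) (suc i) (s≤s i<) with Linked-split p i i<
... | pre , a , b , post , eq , len , r = x ∷ pre , a , b , post , cong (x ∷_) eq , cong suc len , r

module _ {N : ℕ} where
  open import Data.List.Membership.DecPropositional (Fin._≟_ {N}) using () renaming (_∈?_ to _∈ₗ?_)

  toSubset : List (Fin N) → Subset N
  toSubset l = comprehension (_∈ₗ? l)

  ∈-toSubset⁺ : ∀ {l x} → x ∈ₗ l → x ∈ toSubset l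
  ∈-toSubset⁺ {l} = ∈-comprehension⁺ (_∈ₗ? l)

  ∈-toSubset⁻ : ∀ l {x} → x ∈ toSubset l → x ∈ₗ l
  ∈-toSubset⁻ l = ∈-comprehension⁻ (_∈ₗ? l)

toSubset-resp-↭ : ∀ {N} {l l′ : List (Fin N)} → l ↭ l′ → toSubset l ≡ toSubset l′
toSubset-resp-↭ {l = l} {l′} p = ⊆-antisym
  (∈-toSubset⁺ ∘ ∈-resp-↭ p ∘ ∈-toSubset⁻ l)
  (∈-toSubset⁺ ∘ ∈-resp-↭ (↭-sym p) ∘ ∈-toSubset⁻ l′)

module Blocks (s N : ℕ) (χ : Colouring (complete (2 * s) N)) where

  -- As a list, a block has positions at which a vertex can be exchanged, and concatenating blocks
  -- lists the vertices of a path in order.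
  Block : Set
  Block = List (Fin N)

  -- Subsets that are not edges get a junk colour.
  edgeColour : Subset N → Colour
  edgeColour e with ∣ e ∣ ≟ 2 * s
  ... | yes ∣e∣≡2s = χ (e , ∣e∣≡2s)
  ... | no  _      = red

  edgeColour-edge : ∀ e (p : ∣ e ∣ ≡ 2 * s) → χ (e , p) ≡ edgeColour e
  edgeColour-edge e p with ∣ e ∣ ≟ 2 * s
  ... | yes q = cong (λ r → χ (e , r)) (≡-irrelevant p q)
  ... | no ¬p = contradiction p ¬p

  colourOf : Block → Block → Colour
  colourOf A B = edgeColour (toSubset (A ++ B))

  colourOf-sym : ∀ A B → colourOf A B ≡ colourOf B A
  colourOf-sym A B = cong edgeColour (toSubset-resp-↭ (++-comm A B))

  -- Vertex `j` goes to entry `j` of the concatenation. As all blocks have size `s`, edge `i`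
  -- becomes the union of the blocks with indices `i` and `i + 1`, whose colour `Linked` prescribes.
  embedPath : ∀ k {c} Bs → length Bs ≡ k + 1 → All (λ B → length B ≡ s) Bs → Unique (concat Bs) →
    Linked (λ A B → colourOf A B ≡ c) Bs → path k s ↪ colourClass (complete (2 * s) N) χ c
  embedPath k {c} Bs len sizes uniq linked = f , f-injective , f-edge
    where
    total : (k + 1) * s ≡ length (concat Bs)
    total = sym (trans (length-concat Bs sizes) (cong (_* s) len))

    f : Fin ((k + 1) * s) → Fin N
    f = lookup (concat Bs) ∘ cast total

    f-injective : Injective _≡_ _≡_ f
    f-injective {x} {y} eq = toℕ-injective
      (trans (sym (toℕ-cast total x)) (trans (cong toℕ (lookup-injective uniq eq)) (toℕ-cast total y)))

    -- The list and the bounds are variables so that the four equations can be matched with `refl`.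
    image-segment : ∀ {m} (l pre mid post : List (Fin N)) (eq : m ≡ length l) →
      l ≡ pre ++ mid ++ post → ∀ {a b} → length pre ≡ a → length pre + length mid ≡ b →
      image (lookup l ∘ cast eq) (interval m a b) ≡ toSubset mid
    image-segment _ pre mid post refl refl refl refl = ⊆-antisym to from
      where
      l = pre ++ mid ++ post
      g = lookup l ∘ cast refl
      to : image g (interval (length l) (length pre) (length pre + length mid)) ⊆ toSubset mid
      to y∈ with ∈-image⁻ g (interval (length l) (length pre) (length pre + length mid)) y∈
      ... | x , x∈ , refl with ∈-interval⁻ (length pre) (length pre + length mid) x∈
      ... | a≤x , x<b = ∈-toSubset⁺ (lookup-segment⁻ pre mid post (cast refl x)
              (subst (length pre ≤_) (sym (toℕ-cast refl x)) a≤x)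
              (subst (_< length pre + length mid) (sym (toℕ-cast refl x)) x<b))
      from : toSubset mid ⊆ image g (interval (length l) (length pre) (length pre + length mid))
      from y∈ with lookup-segment⁺ pre mid post (∈-toSubset⁻ mid y∈)
      ... | j , a≤j , j<b , refl = subst (λ i → lookup l i ∈ image g _) (Fin.cast-is-id refl j)
              (∈-image⁺ g (∈-interval⁺ a≤j j<b))

    edge-colour : ∀ i → edgeColour (image f (pathEdge k s i)) ≡ c
    edge-colour i with Linked-split linked (toℕ i)
      (subst (suc (toℕ i) <_) (trans (+-comm 1 k) (sym len)) (s≤s (toℕ<n i)))
    ... | pre , A , B , post , refl , len-pre , AB =
      trans (cong edgeColour (image-segment _ (concat pre) (A ++ B) (concat post) total
        (trans (sym (concat-++ pre (A ∷ B ∷ post))) (cong (concat pre ++_) (sym (++-assoc A B (concat post)))))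
        at-i at-i+2)) AB
      where
      sizes-pre = All.++⁻ˡ pre sizes
      at-i : length (concat pre) ≡ toℕ i * s
      at-i = trans (length-concat pre sizes-pre) (cong (_* s) len-pre)
      at-i+2 : length (concat pre) + length (A ++ B) ≡ (toℕ i + 2) * s
      at-i+2 with All.++⁻ʳ pre sizes
      ... | lenA ∷ lenB ∷ _ = trans
              -- `2 * s` unfolds to `s + (s + 0)`.
              (cong₂ _+_ at-i (trans (length-++ A) (cong₂ _+_ lenA (trans lenB (sym (+-identityʳ s))))))
              (sym (*-distribʳ-+ s (toℕ i) 2))

    f-edge : ∀ {e} → Edge (path k s) e → Edge (colourClass (complete (2 * s) N) χ c) (image f e)
    f-edge (i , refl) = size , trans (edgeColour-edge _ size) (edge-colour i)
      where
      size = trans (∣image∣ f f-injective (pathEdge k s i)) (∣pathEdge∣ k s i)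

-- Exchanging the spare vertex

concat-↭ : ∀ {A : Set} {xss yss : List (List A)} → xss ↭ yss → concat xss ↭ concat yss
concat-↭ _↭_.refl        = ↭-refl
concat-↭ (prep xs p)     = ++⁺ˡ xs (concat-↭ p)
concat-↭ (swap xs ys p)  = ↭-trans (shifts xs ys) (++⁺ˡ ys (++⁺ˡ xs (concat-↭ p)))
concat-↭ (_↭_.trans p q) = ↭-trans (concat-↭ p) (concat-↭ q)

Unique-prefix : ∀ {A : Set} (xs : List A) {ys} → Unique (xs ++ ys) → Unique xs
Unique-prefix []       _        = []
Unique-prefix (x ∷ xs) (x∉ ∷ u) = All.++⁻ˡ xs x∉ ∷ Unique-prefix xs u

cutIntoBlocks : ∀ {A : Set} s k (l : List A) → length l ≡ k * s →
  ∃ λ Bs → concat Bs ≡ l × All (λ B → length B ≡ s) Bs × length Bs ≡ k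
cutIntoBlocks s zero    []  _ = [] , refl , [] , refl
cutIntoBlocks s (suc k) l len
  with cutIntoBlocks s k (drop s l)
    (trans (length-drop s l) (trans (cong (_∸ s) len) (m+n∸m≡n s (k * s))))
... | Bs , eq , sizes , lenBs =
  take s l ∷ Bs , trans (cong (take s l ++_) eq) (take++drop≡id s l) ,
  trans (length-take s l) (m≤n⇒m⊓n≡m (subst (s ≤_) (sym len) (m≤m+n s (k * s)))) ∷ sizes ,
  cong suc lenBs

-- Abstracts from the star and the triangle: the first argument of `Config` is the spare vertex, the
-- two lists are the blocks to be traded, and `Goal` is the way out when an exchange destroys the
-- configuration.
module Exchange {A Goal : Set} (Config : A → List A → List A → Set)
  (exchangeˡ : ∀ {w a z} x y → Config w (x ++ a ∷ y) z → Goal ⊎ Config a (x ++ w ∷ y) z)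
  (exchangeʳ : ∀ {w a z} x y → Config w z (x ++ a ∷ y) → Goal ⊎ Config a z (x ++ w ∷ y))
  where

  -- With w the spare vertex, (a b) = (w a)(w b)(w a).
  swapSuffixes : ∀ x y p q {w} → length p ≡ length q →
    Config w (x ++ p) (y ++ q) → Goal ⊎ Config w (x ++ q) (y ++ p)
  swapSuffixes x y []      []      _   c = inj₂ c
  swapSuffixes x y (a ∷ p) (b ∷ q) {w} len c with exchangeˡ x p c
  ... | inj₁ g  = inj₁ g
  ... | inj₂ c₁ with exchangeʳ y q c₁
  ...   | inj₁ g  = inj₁ g
  ...   | inj₂ c₂ with exchangeˡ x p c₂
  ...     | inj₁ g  = inj₁ g
  ...     | inj₂ c₃ = subst₂ (λ X Y → Goal ⊎ Config w X Y) (++-assoc x [ b ] q) (++-assoc y [ a ] p)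
      (swapSuffixes (x ++ [ b ]) (y ++ [ a ]) p q (cong pred len)
        (subst₂ (Config w) (sym (++-assoc x [ b ] p)) (sym (++-assoc y [ a ] q)) c₃))

  swapBlocks : ∀ p q {w} → length p ≡ length q → Config w p q → Goal ⊎ Config w q p
  swapBlocks = swapSuffixes [] []

-- The upper bound

module Upper (s n N : ℕ) (χ : Colouring (complete (2 * s) N)) where

  open Blocks s N χ
  open ColouredGraph colourOf colourOf-sym

  Goal : Set
  Goal = (path n s ↪ colourClass (complete (2 * s) N) χ red)
       ⊎ (path 3 s ↪ colourClass (complete (2 * s) N) χ blue)

  record Valid (w : Fin N) (Bs : List Block) : Set where
    constructor valid
    field
      disjoint : Unique (w ∷ concat Bs)
      sizes    : All (λ B → length B ≡ s) Bs
      number   : length Bs ≡ n + 1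

  Valid-resp-↭ : ∀ {w Bs Cs} → Bs ↭ Cs → Valid w Bs → Valid w Cs
  Valid-resp-↭ p (valid u sz len) = valid
    (Permutationₛ.Unique-resp-↭ (setoid _) (↭⇒↭ₛ (prep _ (concat-↭ p))) u)
    (All-resp-↭ p sz) (trans (sym (↭-length p)) len)

  -- Spare vertex and blocks taken together are merely permuted. Only the first block is treated;
  -- `Valid-resp-↭` brings the others to the front.
  Valid-exchange : ∀ {w a} x y {Bs} → Valid w ((x ++ a ∷ y) ∷ Bs) → Valid a ((x ++ w ∷ y) ∷ Bs)
  Valid-exchange {w} {a} x y (valid u (sz ∷ szs) len) = valid
    (Permutationₛ.Unique-resp-↭ (setoid _) (↭⇒↭ₛ (++⁺ʳ _ exchange)) u)
    (trans (trans (length-++ x) (sym (length-++ x))) sz ∷ szs) len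
    where
    exchange : w ∷ x ++ a ∷ y ↭ a ∷ x ++ w ∷ y
    exchange = ↭-trans (prep w (shift a x y)) (pick (a ∷ x) ↭-refl)

  redPath⇒Goal : ∀ {w Bs} → Valid w Bs → Linked Red Bs → Goal
  redPath⇒Goal (valid (_ ∷ u) sz len) l = inj₁ (embedPath n _ len sz u l)

  blueP₄⇒Goal : ∀ {w Bs} → Valid w Bs → BlueP₄ Bs → Goal
  blueP₄⇒Goal v (blueP₄ {a} {b} {c} {d} {rest} p ab bc cd) with Valid-resp-↭ (↭-sym p) v
  ... | valid (_ ∷ u) sz _ = inj₂ (embedPath 3 abcd refl (All.++⁻ˡ abcd sz)
          (Unique-prefix (concat abcd) (subst Unique (sym (concat-++ abcd rest)) u))
          (ab ∷ bc ∷ cd ∷ [-]))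
    where abcd = a ∷ b ∷ c ∷ d ∷ []

  star⇒Goal : ∀ {w A B C D Bs} → Valid w (A ∷ B ∷ C ∷ D ∷ Bs) → All (Blue A) (B ∷ C ∷ D ∷ Bs) → Goal
  star⇒Goal {w} {A} {B} {C} {D} {Bs} v bs = finish (v , bs)
    where
    Star : Fin N → Block → Block → Set
    Star w X Y = Valid w (X ∷ Y ∷ C ∷ D ∷ Bs) × All (Blue X) (Y ∷ C ∷ D ∷ Bs)

    -- If the new centre is red to some leaf `Y`, list the leaves with `Y` first. By `leaves-red` at
    -- the old centre there is a blue path, or the leaves form a red path, to which the new centre
    -- is prepended.
    exchangeCentre : ∀ {w a Z} x y → Star w (x ++ a ∷ y) Z → Goal ⊎ Star a (x ++ w ∷ y) Z
    exchangeCentre {w} {a} {Z} x y (v , bs) with allBlueOrRed (x ++ w ∷ y) (Z ∷ C ∷ D ∷ Bs)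
    ... | inj₁ bs′ = inj₂ (Valid-exchange x y v , bs′)
    ... | inj₂ (Y , pre , post , eq , r) = inj₁ (redOrP₄ (leaves-red (Y ∷ pre ++ post)
          (≤-trans (s≤s (s≤s (s≤s z≤n))) (≤-reflexive (↭-length p))) (All-resp-↭ p bs)))
      where
      p : Z ∷ C ∷ D ∷ Bs ↭ Y ∷ pre ++ post
      p = ↭-trans (↭-reflexive eq) (shift Y pre post)
      redOrP₄ : BlueP₄ ((x ++ a ∷ y) ∷ Y ∷ pre ++ post) ⊎ Linked Red (Y ∷ pre ++ post) → Goal
      redOrP₄ (inj₁ p₄) = blueP₄⇒Goal v (BlueP₄-resp-↭ (prep _ (↭-sym p)) p₄)
      redOrP₄ (inj₂ l)  = redPath⇒Goal (Valid-resp-↭ (prep _ p) (Valid-exchange x y v)) (r ∷ l)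

    -- Let the new leaf `Y′` be red to `X`. If `Y′ C` is blue, `Y′ C X D` is a blue path. Otherwise
    -- `X Y′` continues in red through the remaining leaves; the old leaf is the one set aside in
    -- `leavesButOne-red`.
    exchangeLeaf : ∀ {w a X} x y → Star w X (x ++ a ∷ y) → Goal ⊎ Star a X (x ++ w ∷ y)
    exchangeLeaf {w} {a} {X} x y (v , bs@(_ ∷ XC ∷ XD ∷ Xs)) = go
      where
      Y′ = x ++ w ∷ y
      v′ : Valid a (X ∷ Y′ ∷ C ∷ D ∷ Bs)
      v′ = Valid-resp-↭ (pick₁ ↭-refl) (Valid-exchange x y (Valid-resp-↭ (pick₁ ↭-refl) v))
      go : Goal ⊎ Star a X Y′
      go with colour X Y′ | colour Y′ C | leavesButOne-red (C ∷ D ∷ Bs) bs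
      ... | inj₂ XY | _       | _       = inj₂ (v′ , XY ∷ XC ∷ XD ∷ Xs)
      ... | inj₁ _  | inj₂ YC | _       =
          inj₁ (blueP₄⇒Goal v′ (blueP₄ (pick₁ (pick₁ ↭-refl)) YC (flip X C XC) XD))
      ... | inj₁ _  | inj₁ _  | inj₁ p₄ = inj₁ (blueP₄⇒Goal v p₄)
      ... | inj₁ XY | inj₁ YC | inj₂ l  = inj₁ (redPath⇒Goal v′ (XY ∷ YC ∷ l))

    open Exchange Star exchangeCentre exchangeLeaf

    finish : Star w A B → Goal
    finish st@(v@(valid _ (lenA ∷ lenB ∷ _) _) , AB ∷ AC ∷ _) with swapBlocks A B (trans lenA (sym lenB)) st
    ... | inj₁ g = g
    -- With `B` as centre `B D` is blue, and the original star completes the path `C A B D`.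
    ... | inj₂ (_ , _ ∷ _ ∷ BD ∷ _) =
      blueP₄⇒Goal v (blueP₄ (pick₂ (pick₀ (pick₀ (pick₀ ↭-refl)))) (flip A C AC) AB BD)

  triangle⇒Goal : ∀ {w A B C D} → Valid w (A ∷ B ∷ C ∷ D ∷ []) → Blue A B → Blue B C → Blue A C → Goal
  triangle⇒Goal {w} {A} {B} {C} {D} v AB BC AC = finish (v , BC , AC)
    where
    -- Only the third corner `X` and the isolated block `Y` trade vertices; `A` and `B` stay, so the
    -- blue edge `A B` is kept outside.
    Triangle : Fin N → Block → Block → Set
    Triangle w X Y = Valid w (A ∷ B ∷ X ∷ Y ∷ []) × Blue B X × Blue A X

    -- A blue edge from `Y` to `A` or `B` prolongs the old triangle to a blue path, so let both be
    -- red. If `X′` is red to `A` and `B`, then `A Y B X′` is a red path. If only `B X′` is red,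
    -- `Y X′` decides between the blue `Y X′ A B` and the red `A Y X′ B`; likewise for `A X′`.
    exchangeCorner : ∀ {w a Y} x y → Triangle w (x ++ a ∷ y) Y → Goal ⊎ Triangle a (x ++ w ∷ y) Y
    exchangeCorner {w} {a} {Y} x y (v , BX , AX) = go
      where
      X′ = x ++ w ∷ y
      v′ : Valid a (A ∷ B ∷ X′ ∷ Y ∷ [])
      v′ = Valid-resp-↭ (pick₂ ↭-refl) (Valid-exchange x y (Valid-resp-↭ (pick₁ (pick₁ ↭-refl)) v))
      go : Goal ⊎ Triangle a X′ Y
      go with colour Y A | colour Y B | colour A X′ | colour B X′ | colour Y X′
      ... | inj₂ YA | _ | _ | _ | _ = inj₁ (blueP₄⇒Goal v (blueP₄ (pick₃ ↭-refl) YA AB BX))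
      ... | _ | inj₂ YB | _ | _ | _ =
          inj₁ (blueP₄⇒Goal v (blueP₄ (pick₃ (pick₁ ↭-refl)) YB (flip A B AB) AX))
      ... | _ | _ | inj₂ AX′ | inj₂ BX′ | _ = inj₂ (v′ , BX′ , AX′)
      ... | inj₁ YA | inj₁ YB | inj₁ AX′ | inj₁ BX′ | _ =
        inj₁ (redPath⇒Goal (Valid-resp-↭ (pick₀ (↭-sym (pick₂ ↭-refl))) v′)
          (flip Y A YA ∷ YB ∷ BX′ ∷ [-]))
      ... | _ | _ | inj₂ AX′ | inj₁ _ | inj₂ YX =
        inj₁ (blueP₄⇒Goal v′ (blueP₄ (pick₃ (pick₂ ↭-refl)) YX (flip A X′ AX′) AB))
      ... | inj₁ YA | _ | inj₂ _ | inj₁ BX′ | inj₁ YX =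
        inj₁ (redPath⇒Goal (Valid-resp-↭ (↭-sym (pick₀ (pick₂ (pick₁ ↭-refl)))) v′)
          (flip Y A YA ∷ YX ∷ flip B X′ BX′ ∷ [-]))
      ... | _ | _ | inj₁ _ | inj₂ BX′ | inj₂ YX =
        inj₁ (blueP₄⇒Goal v′ (blueP₄ (pick₃ (pick₂ (pick₁ ↭-refl))) YX (flip B X′ BX′) (flip A B AB)))
      ... | _ | inj₁ YB | inj₁ AX′ | inj₂ _ | inj₁ YX =
        inj₁ (redPath⇒Goal (Valid-resp-↭ (↭-sym (pick₁ (pick₂ (pick₁ ↭-refl)))) v′)
          (flip Y B YB ∷ YX ∷ flip A X′ AX′ ∷ [-]))

    -- `Triangle` prescribes no colour at the isolated block, so no blue edge is affected.
    exchangeIsolated : ∀ {w a X} x y → Triangle w X (x ++ a ∷ y) → Goal ⊎ Triangle a X (x ++ w ∷ y)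
    exchangeIsolated x y (v , BX , AX) =
      inj₂ (Valid-resp-↭ (pick₃ ↭-refl) (Valid-exchange x y (Valid-resp-↭ (↭-sym (pick₃ ↭-refl)) v)) , BX , AX)

    open Exchange Triangle exchangeCorner exchangeIsolated

    finish : Triangle w C D → Goal
    finish t@(v@(valid _ (_ ∷ _ ∷ lenC ∷ lenD ∷ _) _) , BC , _) with swapBlocks C D (trans lenC (sym lenD)) t
    ... | inj₁ g = g
    -- After the trade `D` is blue to `A`, which prolongs `A B C` to the path `D A B C`.
    ... | inj₂ (_ , BD , AD) = blueP₄⇒Goal v (blueP₄ (pick₃ ↭-refl) (flip A D AD) AB BC)

  valid⇒Goal : 3 ≤ n → ∀ {w Bs} → Valid w Bs → Goal
  valid⇒Goal 3≤n {w} {Bs} v@(valid _ _ number)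
    with outcome Bs (≤-trans (≤-trans 3≤n (m≤m+n n 1)) (≤-reflexive (sym number)))
  ... | redPath ys p l = redPath⇒Goal (Valid-resp-↭ (↭-sym p) v) l
  ... | blueP₄ p₄ = blueP₄⇒Goal v p₄
  ... | blueK₃+K₁ a b c d p ab bc ac = triangle⇒Goal (Valid-resp-↭ (↭-sym p) v) ab bc ac
  ... | blueStar c ls p bs = star (Valid-resp-↭ (↭-sym p) v) bs
    where
    star : ∀ {ls} → Valid w (c ∷ ls) → All (Blue c) ls → Goal
    -- At least four blocks: the centre and the three leaves that `star⇒Goal` names.
    star {ls} v bs with subst (4 ≤_) (sym (Valid.number v)) (+-monoˡ-≤ 1 3≤n)
    star {_ ∷ _ ∷ _ ∷ _} v bs | _ = star⇒Goal v bs
    star {[]} v bs | s≤s ()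
    star {_ ∷ []} v bs | s≤s (s≤s ())
    star {_ ∷ _ ∷ []} v bs | s≤s (s≤s (s≤s ()))

arrows : ∀ s n → 3 ≤ n → Arrows (suc ((n + 1) * s)) (path n s) (path 3 s)
arrows s n 3≤n χ with cutIntoBlocks s (n + 1) (tabulate suc) (length-tabulate suc)
-- The first spare vertex is `zero`; `zero ∷ tabulate suc` is `allFin` by definition.
... | Bs , eq , sizes , number = valid⇒Goal 3≤n {zero}
      (valid (subst (λ l → Unique (zero ∷ l)) (sym eq) (allFin⁺ _)) sizes number)
  where open Upper s n _ χ

-- The lower bound

-- The colouring speaks of edges only, so a vertex of a red path is seen to avoid `zero` through an
-- edge containing it. A vertex outside the shorter path lies in the final block, hence in the final
-- edge.
vertex-in-edge : ∀ n s k → k < (suc n + 1) * s →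
  ∃ λ (i : Fin (suc n)) → toℕ i * s ≤ k × k < (toℕ i + 2) * s
vertex-in-edge zero s k k< = zero , z≤n , k<
vertex-in-edge (suc n) s k k< with k <? (suc n + 1) * s
... | yes k<′ with vertex-in-edge n s k k<′
...   | i , ≤k , k<i rewrite sym (toℕ-inject₁ i) = inject₁ i , ≤k , k<i
vertex-in-edge (suc n) s k k< | no k≮ = fromℕ (suc n) ,
  subst (λ i → i * s ≤ k) (sym (toℕ-fromℕ (suc n))) (≤-trans (*-monoˡ-≤ s (m≤m+n (suc n) 1)) (≮⇒≥ k≮)) ,
  subst (λ i → k < (i + 2) * s) (sym (toℕ-fromℕ (suc n))) (subst (λ j → k < j * s) (sym (+-suc (suc n) 1)) k<)

arrows⇒≤ : ∀ s n → 1 ≤ s → 1 ≤ n → ∀ M → Arrows M (path n s) (path 3 s) → (n + 1) * s < M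
arrows⇒≤ (suc s) (suc n) _ _ zero arrows with arrows (λ _ → red)
-- As `s` is positive the path has a vertex, which has no image in `Fin 0`.
... | inj₁ (f , _) = contradiction (f zero) λ ()
... | inj₂ (f , _) = contradiction (f zero) λ ()
arrows⇒≤ s@(suc _) (suc n) _ _ (suc M) arrows = by-cases (arrows χ)
  where
  χ : Colouring (complete (2 * s) (suc M))
  χ (e , _) with zero ∈? e
  ... | yes _ = blue
  ... | no  _ = red

  0∉red : ∀ e p → χ (e , p) ≡ red → ∀ {x} → x ∈ e → zero ≢ x
  0∉red e p eq x∈e refl with zero ∈? e | eq
  ... | no 0∉e | _ = 0∉e x∈e

  0∈blue : ∀ e p → χ (e , p) ≡ blue → zero ∈ e
  0∈blue e p eq with zero ∈? e | eq
  ... | yes 0∈e | _ = 0∈e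

  by-cases : _ → (suc n + 1) * s < suc M
  -- Punching out `zero` leaves `M` places for the vertices of the red path.
  by-cases (inj₁ (f , f-inj , f-edge)) = s≤s (injective⇒≤ {f = λ x → punchOut (avoid x)}
      (λ {x} {y} eq → f-inj (punchOut-injective (avoid x) (avoid y) eq)))
    where
    avoid : ∀ x → zero ≢ f x
    avoid x with vertex-in-edge n s (toℕ x) (toℕ<n x)
    ... | i , ≤x , x< with f-edge (i , refl)
    ... | p , isRed = 0∉red _ p isRed (∈-image⁺ f (∈-interval⁺ ≤x x<))
  by-cases (inj₂ (f , f-inj , f-edge))
    with f-edge (zero , refl) | f-edge (suc (suc zero) , refl)
  ... | p , blue₁ | q , blue₃
    with ∈-image⁻ f (pathEdge 3 s zero) (0∈blue _ p blue₁)
       | ∈-image⁻ f (pathEdge 3 s (suc (suc zero))) (0∈blue _ q blue₃)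
  ... | x , x∈e₁ , fx≡0 | y , y∈e₃ , fy≡0
    with f-inj (trans fx≡0 (sym fy≡0))
  -- The common preimage of `zero` would be both below `2 * s` and at least `2 * s`.
  ... | refl =
      contradiction (proj₁ (∈-interval⁻ (2 * s) (4 * s) y∈e₃)) (<⇒≱ (proj₂ (∈-interval⁻ 0 (2 * s) x∈e₁)))

theorem1 : (s n : ℕ) → s ≥ 1 → n ≥ 3 →
    IsRamseyNumber (path n s) (path 3 s) ((n + 1) * s + 1)
theorem1 s n s≥1 n≥3 =
  subst (λ N → Arrows N (path n s) (path 3 s)) (+-comm 1 ((n + 1) * s)) (arrows s n n≥3) ,
  λ M h → subst (_≤ M) (+-comm 1 ((n + 1) * s)) (arrows⇒≤ s n s≥1 (≤-trans (s≤s z≤n) n≥3) M h)
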